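{- Let $k\ge 2$ and let $R(x_{k-2},x_{k-1},x_k)$ be a formula of PAF, with free variables $x_{k-2},x_{k-1},x_k$, that represents the relation $r(l,m,n)$ in PAF. Suppose that $R$ is composed of $L_1$ symbols and that the maximal Gödel code among these symbols is $2k+27$ (the code of $x_k$). For a positive integer $L_2$ let $a=(\dots(3!)!\dots)!$ with $L_2$ factorials, let $D(x_k)$ be the formula $$\forall x_{k-2}\bigl((\neg\forall x_{k+1}\neg((\dots((0''')!)!\dots)!=x_{k-2}+x_{k+1}+0'))\to\neg\forall x_{k-1}\neg(R(x_{k-2},x_{k-1},x_k))\bigr)$$ in which the displayed term $(\dots((0''')!)!\dots)!$ contains $L_2$ symbols $!$ (so it denotes $a$), and let $\exists x_kB_D(x_k)$ be the formula $$\neg\forall x_k\Bigl((D(x_k))\to\neg\forall x_{k+2}\bigl((D(x_{k+2}))\to((\forall x_{2k+4}\neg(x_{k+2}=x_k+x_{2k+4}+0')\to\neg\forall x_{2k+5}\neg(x_k=x_{k+2}+x_{2k+5}+0'))\to(\neg\forall x_{2k+6}\neg(x_{k+2}=x_k+x_{2k+6}+0')))\bigr)\Bigr).$$ Let $c$ be the constant (not depending on $L_2$) such that $\exists x_kB_D(x_k)$ is composed of $2L_1+6L_2+c$ symbols. If $L_2>4$, $L_2>2L_1+c+1$ and $2^{L_2}>7L_2(4k+39)$, then the Gödel code of the formula $\exists x_kB_D(x_k)$ is smaller than $a$.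
   Context: PAF is first-order Peano Arithmetic with factorial. Symbols and their Gödel codes: ( has code 3; ) has code 5; comma has code 7; $0$ has code 9; successor $'$ has code 11; $+$ has code 13; $\times$ has code 15; $!$ has code 17; $=$ has code 19; $\neg$ has code 21; $\to$ has code 23; $\forall$ has code 25; the variable $x_k$ has code $2k+27$ ($k=0,1,2,\dots$). Terms: $0$; every variable; and $s'$, $s+t$, $s\times t$, $s!$ for terms $s,t$. Formulas: $s=t$ for terms $s,t$; and $\neg A$, $A\to B$, $\forall x_k(A)$ for formulas $A,B$. Brackets are inserted in terms and formulas wherever needed to make the grouping unambiguous, following a fixed convention. Write $A\wedge B$ for $\neg(A\to\neg B)$ and $\exists x$ for $\neg\forall x\neg$. Axiom schemas ($A,B,C$ any formulas, $x_i,x_j,x_k$ any variables): (10) $A\to(B\to A)$; (11) $(A\to(B\to C))\to((A\to B)\to(A\to C))$; (12) $(\neg A\to\neg B)\to(B\to A)$; (13) $\forall x_kA\to A$, with $x_k$ not free in $A$; (14) $\forall x_kA[x_k]\to A[t]$, with $x_k$ free in $A[x_k]$ and $t$ a term free for $x_k$ in $A[x_k]$; (15) $\forall x_k(A\to B)\to(A\to\forall x_kB)$, with $x_k$ not free in $A$; (16) $x_k=x_k$; (17) $(x_i=x_j)\to(x_j=x_i)$; (18) $(x_i=x_j)\to((x_i=x_k)\to(x_j=x_k))$; (19) $(x_i=x_j)\to(x_i'=x_j')$; (20) $\neg x_k'=0$; (21) $(x_i'=x_j')\to(x_i=x_j)$; (22) $x_k+0=x_k$; (23) $x_i+x_j'=(x_i+x_j)'$;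 (24) $x_k\times0=0$; (25) $x_i\times x_j'=x_i\times x_j+x_i$; (26) $0!=0'$; (27) $(x_k')!=x_k'\times x_k!$; (28) $(A[0]\wedge\forall x_k(A[x_k]\to A[x_k']))\to A[x_k]$, with $x_k$ free in $A[x_k]$. Rules: Modus Ponens (from $A$ and $A\to B$ infer $B$) and Generalization (from $A$ infer $\forall x_kA$). A proof of a formula $F$ is a finite sequence of formulas ending in $F$, each of which is an axiom or follows from earlier ones by a rule. Gödel codes: let $p_i$ be the $(i+1)$th prime ($p_0=2,p_1=3,\dots$). A formula that is the symbol string $\alpha_0\alpha_1\dots\alpha_n$ has Gödel code $p_0^{\#\alpha_0}p_1^{\#\alpha_1}\cdots p_n^{\#\alpha_n}$, where $\#\alpha_i$ is the code of $\alpha_i$. A proof $F_0,\dots,F_n$ has Gödel code $p_0^{\#F_0}\cdots p_n^{\#F_n}$. The numeral $0^{(n)}$ is $0$ followed by $n$ successor symbols. B-formulas: for a formula $A(x)$ with one free variable $x$, the associated B-formula $\exists xB_A(x)$ is, in standard symbols, $$\neg\forall x\bigl(A(x)\to\neg\forall y(A(y)\to((\forall u\neg(y=x+u+0')\to\neg\forall v\neg(x=y+v+0'))\to(\neg\forall w\neg(y=x+w+0'))))\bigr),$$ where $x,y,u,v,w$ are variables of the language; here $A(y)$ is $A$ with $x$ replaced by $y$, bound variables being renamed if needed. It expresses that there is an $x$ that is the least number satisfying $A$. Only formulas of this exact form are called B-formulas. The formula $\neg B_A(n)$ is, in standard symbols, $$A(0^{(n)})\to\neg\forall y(A(y)\to((\forall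 u\neg(y=0^{(n)}+u+0')\to\neg\forall v\neg(0^{(n)}=y+v+0'))\to(\neg\forall w\neg(y=0^{(n)}+w+0')))).$$ The relation $r(l,m,n)$ on natural numbers holds if and only if $l$ is the Gödel code of a B-formula $\exists xB_A(x)$ and $m$ is the Gödel code of a proof in PAF of $\neg B_A(n)$. A formula $R$ represents $r$ in PAF if, for all $l,m,n$, PAF entails $R(0^{(l)},0^{(m)},0^{(n)})$ when $r(l,m,n)$ holds and entails $\neg R(0^{(l)},0^{(m)},0^{(n)})$ when it does not. In the claim, the variables occurring in $D(x_k)$ are among $x_0,\dots,x_{k+1}$. $D(x_{k+2})$ denotes the formula obtained from $D(x_k)$ by renaming its variables injectively to variables among $x_{k+2},\dots,x_{2k+3}$, with the free variable $x_k$ renamed to $x_{k+2}$; it therefore has the same number of symbols as $D(x_k)$. Each formula is identified with its symbol string, including brackets. The constant $c$ accounts for all symbols of $\exists x_kB_D(x_k)$ other than the symbols of the two copies of $R$ and the $3$ symbols "(", ")", "!" per factorial in each of the two occurrences of the term denoting $a$. -}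

module Defs where

open import Data.Empty using (⊥; ⊥-elim)
open import Data.Fin using (Fin)
import Data.Fin as Fin
open import Data.List using (List; []; _∷_; _++_; [_]; length; map; lookup; last)
open import Data.List.Relation.Unary.All using (All; _∷_)
open import Data.List.Relation.Unary.Unique.Propositional using (Unique)
open import Data.Maybe using (just)
open import Data.Nat
open import Data.Nat.Divisibility using (_∣_; ∣-trans; ∣m+n∣m⇒∣n; ∣1⇒≡1; m∣m*n; m≤n⇒m!∣n!)
open import Data.Nat.GeneralisedArithmetic using (fold)
open import Data.Nat.ListAction using (product)
open import Data.Nat.Primality using (Prime; prime?; ¬prime[1]; prime⇒nonZero)
open import Data.Nat.Primality.Factorisation using (factorise; module PrimeFactorisation)
open import Data.Nat.Properties
open import Data.Product using (Σ-syntax; ∃; ∃-syntax; _×_; _,_; proj₁; proj₂)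
open import Data.Sum using (_⊎_)
open import Data.Unit using (⊤)
open import Function using (_⇔_; Injective)
open import Relation.Binary.PropositionalEquality hiding ([_])
open import Relation.Nullary using (¬_; yes; no; does)
open import Data.Bool using (if_then_else_)

------------------------------------------------------------------------
-- The sequence of primes

NextPrime : ℕ → Set
NextPrime n = ∃[ q ] (n < q × Prime q × (∀ {r} → n < r → Prime r → q ≤ r))

private
  primeAbove : ∀ n → ∃[ q ] (n < q × Prime q)
  primeAbove n = go (factors F) (isFactorisation F) (factorsPrime F)
    where
    open PrimeFactorisation
    F = factorise (suc (n !))

    go : ∀ qs → suc (n !) ≡ product qs → All Prime qs → ∃[ q ] (n < q × Prime q)
    go []       eq _        = ⊥-elim (m<n⇒n≢0 (1≤n! n) (suc-injective eq))
    go (q ∷ qs) eq (pr ∷ _) = q , ≰⇒> q≰n , pr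
      where
      ∣! : ∀ m → .⦃ NonZero m ⦄ → m ∣ m !
      ∣! (suc m) = m∣m*n (m !)
      q≰n : ¬ (q ≤ n)
      q≰n q≤n = ¬prime[1] (subst Prime (∣1⇒≡1 q∣1) pr)
        where
        q∣1+n! : q ∣ n ! + 1
        q∣1+n! = subst (q ∣_) (trans (sym eq) (+-comm 1 (n !))) (m∣m*n (product qs))
        q∣1 : q ∣ 1
        q∣1 = ∣m+n∣m⇒∣n q∣1+n! (∣-trans (∣! q ⦃ prime⇒nonZero pr ⦄) (m≤n⇒m!∣n! q≤n))

  search : ∀ d n {q} → q ≤ d + n → n < q → Prime q → NextPrime n
  search zero    n q≤n n<q _ = ⊥-elim (<⇒≱ n<q q≤n)
  search (suc d) n {q} q≤d+n n<q pr with prime? (suc n)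
  ... | yes pr′ = suc n , ≤-refl , pr′ , λ n<r _ → n<r
  ... | no ¬pr = r , <-trans (n<1+n n) n<r , prime-r , least
    where
    ≢prime : ∀ {m} → n < m → Prime m → suc n < m
    ≢prime n<m pm = ≤∧≢⇒< n<m λ { refl → ¬pr pm }
    next  = search d (suc n) (subst (q ≤_) (sym (+-suc d n)) q≤d+n) (≢prime n<q pr) pr
    r     = proj₁ next
    n<r   = proj₁ (proj₂ next)
    prime-r = proj₁ (proj₂ (proj₂ next))
    least : ∀ {m} → n < m → Prime m → r ≤ m
    least n<m pm = proj₂ (proj₂ (proj₂ next)) (≢prime n<m pm) pm

nextPrime : ∀ n → NextPrime n
nextPrime n with primeAbove n
... | q , n<q , pr = search q n (m≤m+n q n) n<q pr

p : ℕ → ℕ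
p zero    = 2
p (suc i) = proj₁ (nextPrime (p i))

-- primeCodeFrom i (a₀ ∷ a₁ ∷ …) is p i ^ a₀ * p (i + 1) ^ a₁ * …
primeCodeFrom : ℕ → List ℕ → ℕ
primeCodeFrom i []       = 1
primeCodeFrom i (a ∷ as) = p i ^ a * primeCodeFrom (suc i) as

primeCode : List ℕ → ℕ
primeCode = primeCodeFrom 0

------------------------------------------------------------------------
-- Terms and formulas

infixl 9 _′ _!ᵗ
infixl 8 _⊗_
infixl 7 _⊕_
infix  6 _≐_
infix  5 ~_ ∀[_]_
infixr 4 _⊃_

data Term : Set where
  var     : ℕ → Term
  𝟎       : Term
  _′ _!ᵗ  : Term → Term
  _⊕_ _⊗_ : Term → Term → Term

data Formula : Set where
  _≐_   : Term → Term → Formula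
  ~_    : Formula → Formula
  _⊃_   : Formula → Formula → Formula
  ∀[_]_ : ℕ → Formula → Formula

infixr 5 _∧_

_∧_ : Formula → Formula → Formula
A ∧ B = ~ (A ⊃ ~ B)

numeral : ℕ → Term
numeral = fold 𝟎 _′

OccursIn : ℕ → Term → Set
OccursIn x (var y) = x ≡ y
OccursIn x 𝟎       = ⊥
OccursIn x (s ′)   = OccursIn x s
OccursIn x (s !ᵗ)  = OccursIn x s
OccursIn x (s ⊕ t) = OccursIn x s ⊎ OccursIn x t
OccursIn x (s ⊗ t) = OccursIn x s ⊎ OccursIn x t

Free : ℕ → Formula → Set
Free x (s ≐ t)    = OccursIn x s ⊎ OccursIn x t
Free x (~ A)      = Free x A
Free x (A ⊃ B)    = Free x A ⊎ Free x B
Free x (∀[ y ] A) = x ≢ y × Free x A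

FreeFor : Term → ℕ → Formula → Set
FreeFor t x (s ≐ u)    = ⊤
FreeFor t x (~ A)      = FreeFor t x A
FreeFor t x (A ⊃ B)    = FreeFor t x A × FreeFor t x B
FreeFor t x (∀[ y ] A) = ¬ Free x (∀[ y ] A) ⊎ (¬ OccursIn y t × FreeFor t x A)

infixl 10 _⟦_≔_⟧ᵗ _⟦_≔_⟧

_⟦_≔_⟧ᵗ : Term → ℕ → Term → Term
var y   ⟦ x ≔ t ⟧ᵗ = if does (y ≟ x) then t else var y
𝟎       ⟦ x ≔ t ⟧ᵗ = 𝟎
(s ′)   ⟦ x ≔ t ⟧ᵗ = (s ⟦ x ≔ t ⟧ᵗ) ′
(s !ᵗ)  ⟦ x ≔ t ⟧ᵗ = (s ⟦ x ≔ t ⟧ᵗ) !ᵗ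
(s ⊕ u) ⟦ x ≔ t ⟧ᵗ = s ⟦ x ≔ t ⟧ᵗ ⊕ u ⟦ x ≔ t ⟧ᵗ
(s ⊗ u) ⟦ x ≔ t ⟧ᵗ = s ⟦ x ≔ t ⟧ᵗ ⊗ u ⟦ x ≔ t ⟧ᵗ

-- Replaces free occurrences only and never renames, so it is meaningful under FreeFor.
_⟦_≔_⟧ : Formula → ℕ → Term → Formula
(s ≐ u)    ⟦ x ≔ t ⟧ = s ⟦ x ≔ t ⟧ᵗ ≐ u ⟦ x ≔ t ⟧ᵗ
(~ A)      ⟦ x ≔ t ⟧ = ~ A ⟦ x ≔ t ⟧
(A ⊃ B)    ⟦ x ≔ t ⟧ = A ⟦ x ≔ t ⟧ ⊃ B ⟦ x ≔ t ⟧
(∀[ y ] A) ⟦ x ≔ t ⟧ = if does (y ≟ x) then ∀[ y ] A else ∀[ y ] A ⟦ x ≔ t ⟧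

renameᵗ : (ℕ → ℕ) → Term → Term
renameᵗ ρ (var x) = var (ρ x)
renameᵗ ρ 𝟎       = 𝟎
renameᵗ ρ (s ′)   = renameᵗ ρ s ′
renameᵗ ρ (s !ᵗ)  = renameᵗ ρ s !ᵗ
renameᵗ ρ (s ⊕ t) = renameᵗ ρ s ⊕ renameᵗ ρ t
renameᵗ ρ (s ⊗ t) = renameᵗ ρ s ⊗ renameᵗ ρ t

-- Renames every variable, bound ones included.
rename : (ℕ → ℕ) → Formula → Formula
rename ρ (s ≐ t)    = renameᵗ ρ s ≐ renameᵗ ρ t
rename ρ (~ A)      = ~ rename ρ A
rename ρ (A ⊃ B)    = rename ρ A ⊃ rename ρ B
rename ρ (∀[ x ] A) = ∀[ ρ x ] rename ρ A

infix 3 _⊢_~ᵛ_ _⊢_~ᵗ_ _⊢_~ᶠ_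

-- Equality up to bound variables. The pairs in Γ are the variables to be
-- identified, innermost binder first; a variable outside Γ matches nothing.
data _⊢_~ᵛ_ : List (ℕ × ℕ) → ℕ → ℕ → Set where
  here  : ∀ {Γ x y} → ((x , y) ∷ Γ) ⊢ x ~ᵛ y
  there : ∀ {Γ x y x′ y′} → x ≢ x′ → y ≢ y′ → Γ ⊢ x ~ᵛ y → ((x′ , y′) ∷ Γ) ⊢ x ~ᵛ y

data _⊢_~ᵗ_ (Γ : List (ℕ × ℕ)) : Term → Term → Set where
  var  : ∀ {x y} → Γ ⊢ x ~ᵛ y → Γ ⊢ var x ~ᵗ var y
  𝟎    : Γ ⊢ 𝟎 ~ᵗ 𝟎
  _′   : ∀ {s s′} → Γ ⊢ s ~ᵗ s′ → Γ ⊢ s ′ ~ᵗ s′ ′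
  _!ᵗ  : ∀ {s s′} → Γ ⊢ s ~ᵗ s′ → Γ ⊢ s !ᵗ ~ᵗ s′ !ᵗ
  _⊕_  : ∀ {s s′ t t′} → Γ ⊢ s ~ᵗ s′ → Γ ⊢ t ~ᵗ t′ → Γ ⊢ s ⊕ t ~ᵗ s′ ⊕ t′
  _⊗_  : ∀ {s s′ t t′} → Γ ⊢ s ~ᵗ s′ → Γ ⊢ t ~ᵗ t′ → Γ ⊢ s ⊗ t ~ᵗ s′ ⊗ t′

data _⊢_~ᶠ_ (Γ : List (ℕ × ℕ)) : Formula → Formula → Set where
  _≐_ : ∀ {s s′ t t′} → Γ ⊢ s ~ᵗ s′ → Γ ⊢ t ~ᵗ t′ → Γ ⊢ s ≐ t ~ᶠ (s′ ≐ t′)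
  ~_  : ∀ {A A′} → Γ ⊢ A ~ᶠ A′ → Γ ⊢ ~ A ~ᶠ (~ A′)
  _⊃_ : ∀ {A A′ B B′} → Γ ⊢ A ~ᶠ A′ → Γ ⊢ B ~ᶠ B′ → Γ ⊢ A ⊃ B ~ᶠ (A′ ⊃ B′)
  ∀ᶠ  : ∀ {x y A A′} → ((x , y) ∷ Γ) ⊢ A ~ᶠ A′ → Γ ⊢ ∀[ x ] A ~ᶠ (∀[ y ] A′)

------------------------------------------------------------------------
-- PAF

data Axiom : Formula → Set where
  K              : ∀ A B → Axiom (A ⊃ (B ⊃ A))
  S              : ∀ A B C → Axiom ((A ⊃ (B ⊃ C)) ⊃ ((A ⊃ B) ⊃ (A ⊃ C)))
  contraposition : ∀ A B → Axiom ((~ A ⊃ ~ B) ⊃ (B ⊃ A))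
  ∀-vacuous      : ∀ A k → ¬ Free k A → Axiom ((∀[ k ] A) ⊃ A)
  ∀-elim         : ∀ A k t → Free k A → FreeFor t k A → Axiom ((∀[ k ] A) ⊃ A ⟦ k ≔ t ⟧)
  ∀-distrib      : ∀ A B k → ¬ Free k A → Axiom ((∀[ k ] (A ⊃ B)) ⊃ (A ⊃ ∀[ k ] B))
  ≐-refl         : ∀ k → Axiom (var k ≐ var k)
  ≐-sym          : ∀ i j → Axiom (var i ≐ var j ⊃ var j ≐ var i)
  ≐-trans        : ∀ i j k → Axiom (var i ≐ var j ⊃ (var i ≐ var k ⊃ var j ≐ var k))
  ′-cong         : ∀ i j → Axiom (var i ≐ var j ⊃ var i ′ ≐ var j ′)
  ′≢𝟎            : ∀ k → Axiom (~ (var k ′ ≐ 𝟎))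
  ′-injective    : ∀ i j → Axiom (var i ′ ≐ var j ′ ⊃ var i ≐ var j)
  ⊕-𝟎            : ∀ k → Axiom (var k ⊕ 𝟎 ≐ var k)
  ⊕-′            : ∀ i j → Axiom (var i ⊕ var j ′ ≐ (var i ⊕ var j) ′)
  ⊗-𝟎            : ∀ k → Axiom (var k ⊗ 𝟎 ≐ 𝟎)
  ⊗-′            : ∀ i j → Axiom (var i ⊗ var j ′ ≐ var i ⊗ var j ⊕ var i)
  !-𝟎            : Axiom (𝟎 !ᵗ ≐ 𝟎 ′)
  !-′            : ∀ k → Axiom (var k ′ !ᵗ ≐ var k ′ ⊗ var k !ᵗ)
  induction      : ∀ A k → Free k A →
                   Axiom ((A ⟦ k ≔ 𝟎 ⟧ ∧ ∀[ k ] (A ⊃ A ⟦ k ≔ var k ′ ⟧)) ⊃ A)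

data Justified (Fs : List Formula) (i : Fin (length Fs)) : Set where
  axiom          : Axiom (lookup Fs i) → Justified Fs i
  modusPonens    : ∀ j h → j Fin.< i → h Fin.< i →
                   lookup Fs h ≡ (lookup Fs j ⊃ lookup Fs i) → Justified Fs i
  generalization : ∀ j k → j Fin.< i →
                   lookup Fs i ≡ (∀[ k ] lookup Fs j) → Justified Fs i

IsProofOf : List Formula → Formula → Set
IsProofOf Fs F = (∀ i → Justified Fs i) × last Fs ≡ just F

PAF⊢_ : Formula → Set
PAF⊢ F = ∃[ Fs ] IsProofOf Fs F

------------------------------------------------------------------------
-- Symbol strings and Gödel codes

data Symbol : Set where
  lpar rpar comma zero succ plus times fact equals neg implies forAll : Symbol
  variable! : ℕ → Symbol

# : Symbol → ℕ
# lpar          = 3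
# rpar          = 5
# comma         = 7
# zero          = 9
# succ          = 11
# plus          = 13
# times         = 15
# fact          = 17
# equals        = 19
# neg           = 21
# implies       = 23
# forAll        = 25
# (variable! k) = 2 * k + 27

infix 3 _spells_ _spellsᵗ_

-- w spells A: w is A written out with some choice of brackets around its
-- subterms and subformulas.
data _spellsᵗ_ : List Symbol → Term → Set where
  var      : ∀ k → [ variable! k ] spellsᵗ var k
  𝟎        : [ zero ] spellsᵗ 𝟎
  _′       : ∀ {w s} → w spellsᵗ s → w ++ [ succ ] spellsᵗ s ′
  _!ᵗ      : ∀ {w s} → w spellsᵗ s → w ++ [ fact ] spellsᵗ s !ᵗ
  _⊕_      : ∀ {v w s t} → v spellsᵗ s → w spellsᵗ t → v ++ plus ∷ w spellsᵗ s ⊕ t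
  _⊗_      : ∀ {v w s t} → v spellsᵗ s → w spellsᵗ t → v ++ times ∷ w spellsᵗ s ⊗ t
  brackets : ∀ {w s} → w spellsᵗ s → lpar ∷ w ++ [ rpar ] spellsᵗ s

data _spells_ : List Symbol → Formula → Set where
  _≐_      : ∀ {v w s t} → v spellsᵗ s → w spellsᵗ t → v ++ equals ∷ w spells s ≐ t
  ~_       : ∀ {w A} → w spells A → neg ∷ w spells ~ A
  _⊃_      : ∀ {v w A B} → v spells A → w spells B → v ++ implies ∷ w spells A ⊃ B
  ∀[_]_    : ∀ {w A} k → w spells A → forAll ∷ variable! k ∷ w spells ∀[ k ] A
  brackets : ∀ {w A} → w spells A → lpar ∷ w ++ [ rpar ] spells A

-- A fixed way of inserting brackets under which no string is ambiguous.
record BracketConvention : Set where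
  field
    string        : Formula → List Symbol
    string-spells : ∀ A → string A spells A
    unambiguous   : Injective _≡_ _≡_ string

module Coding (conv : BracketConvention) where
  open BracketConvention conv

  formulaCode : Formula → ℕ
  formulaCode A = primeCode (map # (string A))

  proofCode : List Formula → ℕ
  proofCode Fs = primeCode (map formulaCode Fs)

------------------------------------------------------------------------
-- B-formulas

-- For A′ = A(y): every y with A(y) satisfies (t < y or y < t) implies t < y,
-- the disjunction being written as an implication. Sums associate to the left.
minimal : Formula → Term → (y u v w : ℕ) → Formula
minimal A′ t y u v w =
  ∀[ y ] (A′ ⊃ ((∀[ u ] ~ (var y ≐ t ⊕ var u ⊕ 𝟎 ′)) ⊃ ~ ∀[ v ] ~ (t ≐ var y ⊕ var v ⊕ 𝟎 ′))
             ⊃ ~ ∀[ w ] ~ (var y ≐ t ⊕ var w ⊕ 𝟎 ′))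

-- A′ is A(y).
∃B : (A A′ : Formula) (x y u v w : ℕ) → Formula
∃B A A′ x y u v w = ~ ∀[ x ] (A ⊃ ~ minimal A′ (var x) y u v w)

¬B : (A A′ : Formula) (x y u v w n : ℕ) → Formula
¬B A A′ x y u v w n = A ⟦ x ≔ numeral n ⟧ ⊃ ~ minimal A′ (numeral n) y u v w

module Relation-r (conv : BracketConvention) where
  open Coding conv

  r : (l m n : ℕ) → Set
  r l m n =
    Σ[ A ∈ Formula ] Σ[ A′ ∈ Formula ] ∃[ x ] ∃[ y ] ∃[ u ] ∃[ v ] ∃[ w ]
      Unique (x ∷ y ∷ u ∷ v ∷ w ∷ [])
    × (∀ z → Free z A ⇔ z ≡ x)
    × [ (x , y) ] ⊢ A ~ᶠ A′
    × l ≡ formulaCode (∃B A A′ x y u v w)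
    × ∃[ Fs ] (IsProofOf Fs (¬B A A′ x y u v w n) × m ≡ proofCode Fs)

  Represents-r : (R : Formula) (x y z : ℕ) → Set
  Represents-r R x y z = ∀ l m n →
    let Rlmn = R ⟦ x ≔ numeral l ⟧ ⟦ y ≔ numeral m ⟧ ⟦ z ≔ numeral n ⟧
    in (r l m n → PAF⊢ Rlmn) × (¬ r l m n → PAF⊢ (~ Rlmn))

------------------------------------------------------------------------
-- The formula D and its B-formula

aᵗ : ℕ → Term
aᵗ L₂ = fold (numeral 3) _!ᵗ L₂

a : ℕ → ℕ
a L₂ = fold 3 _! L₂

D : (R : Formula) (k L₂ : ℕ) → Formula
D R k L₂ =
  ∀[ k ∸ 2 ] ((~ ∀[ k + 1 ] ~ (aᵗ L₂ ≐ var (k ∸ 2) ⊕ var (k + 1) ⊕ 𝟎 ′))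
              ⊃ ~ ∀[ k ∸ 1 ] ~ R)

∃B-D : (R : Formula) (k : ℕ) (ρ : ℕ → ℕ) (L₂ : ℕ) → Formula
∃B-D R k ρ L₂ =
  ∃B (D R k L₂) (rename ρ (D R k L₂)) k (k + 2) (2 * k + 4) (2 * k + 5) (2 * k + 6)

record ShiftsVariables (k : ℕ) (ρ : ℕ → ℕ) : Set where
  field
    lower     : ∀ {i} → i ≤ k + 1 → k + 2 ≤ ρ i
    upper     : ∀ {i} → i ≤ k + 1 → ρ i ≤ 2 * k + 3
    injective : ∀ {i j} → i ≤ k + 1 → j ≤ k + 1 → ρ i ≡ ρ j → i ≡ j
    free      : ρ k ≡ k + 2

-- By Euclid's argument p i ≤ 2 ^ 2 ^ i, so a string of n symbols with codes at
-- most M has Gödel code at most 2 ^ (M * 2 ^ n). Here n < 7 * L₂, M = 4 * k + 39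
-- is the code of x_{2k+6} and M < 2 ^ L₂, which gives a code below
-- 2 ^ 2 ^ (8 * L₂). On the other side a L₂ ≥ 2 ^ 2 ^ a (L₂ ∸ 2), since 2 ^ n ≤ n !
-- for n ≥ 4, and a (L₂ ∸ 2) ≥ 8 * L₂.

module Submission where

open import Defs
open import Data.List using (List; []; _∷_; length; map)
open import Data.List.Extrema.Nat using (max; xs≤max)
open import Data.List.Properties using (length-map)
open import Data.List.Relation.Unary.All using (All; []; _∷_)
open import Data.List.Relation.Unary.All.Properties using (map⁺; map⁻; ++⁺; ++⁻; ∷ʳ⁺; ∷ʳ⁻)
open import Data.Bool using (T)
open import Data.Nat
open import Data.Nat.Divisibility using (_∣_; ∣-refl; ∣m⇒∣m*n; ∣n⇒∣m*n; m∣m*n; ∣m+n∣m⇒∣n; ∣1⇒≡1; ∣⇒≤)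
open import Data.Nat.ListAction using (product)
open import Data.Nat.Primality
open import Data.Nat.Primality.Factorisation using (factorise; module PrimeFactorisation)
open import Data.Nat.Properties
open import Data.Nat.Tactic.RingSolver using (solve-∀)
open import Data.Product using (∃-syntax; _×_; _,_; proj₁; proj₂)
open import Data.Sum using (_⊎_)
open import Data.Unit using (⊤)
open import Function using (_⇔_)
open import Relation.Binary.PropositionalEquality
  using (_≡_; refl; sym; trans; cong; subst)
open import Relation.Nullary using (¬_; contradiction)
open import Relation.Binary.Definitions using (tri<; tri≈; tri>)

-- Euclid's bound on the sequence of primes.

p-prime : ∀ i → Prime (p i)
p-prime zero    = prime[2]
p-prime (suc i) = proj₁ (proj₂ (proj₂ (nextPrime (p i))))

p-least : ∀ i {q} → p i < q → Prime q → p (suc i) ≤ q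
p-least i = proj₂ (proj₂ (proj₂ (nextPrime (p i))))

∃-primeDivisor : ∀ n → 1 < n → ∃[ q ] (Prime q × q ∣ n)
∃-primeDivisor n@(suc _) 1<n = go (factors F) (isFactorisation F) (factorsPrime F)
  where
  open PrimeFactorisation
  F = factorise n

  go : ∀ qs → n ≡ product qs → All Prime qs → ∃[ q ] (Prime q × q ∣ n)
  go []       n≡1 _        = contradiction (sym n≡1) (<⇒≢ 1<n)
  go (q ∷ qs) n≡  (pr ∷ _) = q , pr , subst (q ∣_) (sym n≡) (m∣m*n (product qs))

primorial : ℕ → ℕ
primorial zero    = 1
primorial (suc i) = primorial i * p i

primorial≥1 : ∀ i → 1 ≤ primorial i
primorial≥1 zero    = ≤-refl
primorial≥1 (suc i) = *-mono-≤ (primorial≥1 i) (>-nonZero⁻¹ (p i) ⦃ prime⇒nonZero (p-prime i) ⦄)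

-- By `p-least` no prime lies strictly between `p i` and `p (suc i)`, so a prime below `p (suc i)`
-- is either the new factor `p i` or smaller, where induction applies.
prime<p⇒∣primorial : ∀ i {q} → Prime q → q < p i → q ∣ primorial i
prime<p⇒∣primorial zero    pr q<2 =
  contradiction q<2 (≤⇒≯ (nonTrivial⇒n>1 _ ⦃ prime⇒nonTrivial pr ⦄))
prime<p⇒∣primorial (suc i) {q} pr q<p with <-cmp q (p i)
... | tri< q<pᵢ _ _ = ∣m⇒∣m*n (p i) (prime<p⇒∣primorial i pr q<pᵢ)
... | tri≈ _ refl _ = ∣n⇒∣m*n (primorial i) ∣-refl
... | tri> _ _ pᵢ<q = contradiction q<p (≤⇒≯ (p-least i pᵢ<q pr))

-- Euclid's argument: a prime divisor of `primorial i + 1` that was below `p i` would also divide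
-- `primorial i`, hence 1. So it is at least `p i`.
p≤1+primorial : ∀ i → p i ≤ primorial i + 1
p≤1+primorial i with ∃-primeDivisor (primorial i + 1) (+-monoˡ-≤ 1 (primorial≥1 i))
... | q , pr , q∣ = ≤-trans (≮⇒≥ q≮p) q≤
  where
  q≤ : q ≤ primorial i + 1
  q≤ = ∣⇒≤ ⦃ >-nonZero (m≤n+m 1 (primorial i)) ⦄ q∣
  q≮p : ¬ (q < p i)
  q≮p q<p = ¬prime[1] (subst Prime (∣1⇒≡1 (∣m+n∣m⇒∣n q∣ (prime<p⇒∣primorial i pr q<p))) pr)

open ≤-Reasoning

2^-suc : ∀ n → 2 ^ suc n ≡ 2 ^ n + 2 ^ n
2^-suc n = cong (2 ^ n +_) (+-identityʳ (2 ^ n))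

p≤2*primorial : ∀ i → p i ≤ primorial i * 2
p≤2*primorial i = begin
  p i                       ≤⟨ p≤1+primorial i ⟩
  primorial i + 1           ≤⟨ +-monoʳ-≤ (primorial i) (primorial≥1 i) ⟩
  primorial i + primorial i ≡⟨ double (primorial i) ⟩
  primorial i * 2           ∎
  where
  double : ∀ x → x + x ≡ x * 2
  double = solve-∀

-- The factor 2 makes the induction close: as `p i` is at most `primorial i * 2`, each step at most
-- squares the left side, and it exactly squares the right side.
2*primorial≤2^2^ : ∀ i → primorial i * 2 ≤ 2 ^ 2 ^ i
2*primorial≤2^2^ zero    = ≤-refl
2*primorial≤2^2^ (suc i) = begin
  P * p i * 2             ≡⟨ rearrange P (p i) ⟩
  P * 2 * p i             ≤⟨ *-mono-≤ IH (≤-trans (p≤2*primorial i) IH) ⟩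
  2 ^ 2 ^ i * 2 ^ 2 ^ i   ≡⟨ ^-distribˡ-+-* 2 (2 ^ i) (2 ^ i) ⟨
  2 ^ (2 ^ i + 2 ^ i)     ≡⟨ cong (2 ^_) (2^-suc i) ⟨
  2 ^ 2 ^ suc i           ∎
  where
  P  = primorial i
  IH = 2*primorial≤2^2^ i
  rearrange : ∀ x y → x * y * 2 ≡ x * 2 * y
  rearrange = solve-∀

p≤2^2^ : ∀ i → p i ≤ 2 ^ 2 ^ i
p≤2^2^ i = ≤-trans (p≤2*primorial i) (2*primorial≤2^2^ i)

-- Size of prime codes.

-- The extra factor 2 ^ (2 ^ i * M) on the left makes the exponents telescope.
primeCodeFrom-bound : ∀ M i as → All (_≤ M) as →
  primeCodeFrom i as * 2 ^ (2 ^ i * M) ≤ 2 ^ (2 ^ (i + length as) * M)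
primeCodeFrom-bound M i []       []           = begin
  1 * 2 ^ (2 ^ i * M)   ≡⟨ *-identityˡ _ ⟩
  2 ^ (2 ^ i * M)       ≡⟨ cong (λ j → 2 ^ (2 ^ j * M)) (+-identityʳ i) ⟨
  2 ^ (2 ^ (i + 0) * M) ∎
primeCodeFrom-bound M i (α ∷ as) (α≤M ∷ as≤M) = begin
  p i ^ α * X * Y                         ≤⟨ *-monoˡ-≤ Y (*-monoˡ-≤ X pᵢ^α≤Y) ⟩
  Y * X * Y                               ≡⟨ rearrange X Y ⟩
  X * (Y * Y)                             ≡⟨ cong (X *_) Y*Y ⟩
  X * 2 ^ (2 ^ suc i * M)                 ≤⟨ primeCodeFrom-bound M (suc i) as as≤M ⟩
  2 ^ (2 ^ (suc i + length as) * M)       ≡⟨ cong (λ j → 2 ^ (2 ^ j * M)) (+-suc i (length as)) ⟨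
  2 ^ (2 ^ (i + length (α ∷ as)) * M)     ∎
  where
  X = primeCodeFrom (suc i) as
  Y = 2 ^ (2 ^ i * M)
  rearrange : ∀ x y → y * x * y ≡ x * (y * y)
  rearrange = solve-∀
  pᵢ^α≤Y : p i ^ α ≤ Y
  pᵢ^α≤Y = begin
    p i ^ α           ≤⟨ ^-monoˡ-≤ α (p≤2^2^ i) ⟩
    (2 ^ 2 ^ i) ^ α   ≡⟨ ^-*-assoc 2 (2 ^ i) α ⟩
    2 ^ (2 ^ i * α)   ≤⟨ ^-monoʳ-≤ 2 (*-monoʳ-≤ (2 ^ i) α≤M) ⟩
    2 ^ (2 ^ i * M)   ∎
  Y*Y : Y * Y ≡ 2 ^ (2 ^ suc i * M)
  Y*Y = begin-equality
    Y * Y                       ≡⟨ ^-distribˡ-+-* 2 (2 ^ i * M) (2 ^ i * M) ⟨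
    2 ^ (2 ^ i * M + 2 ^ i * M) ≡⟨ cong (2 ^_) (*-distribʳ-+ M (2 ^ i) (2 ^ i)) ⟨
    2 ^ ((2 ^ i + 2 ^ i) * M)   ≡⟨ cong (λ j → 2 ^ (j * M)) (2^-suc i) ⟨
    2 ^ (2 ^ suc i * M)         ∎

primeCode-bound : ∀ M as → All (_≤ M) as → primeCode as ≤ 2 ^ (2 ^ length as * M)
primeCode-bound M as as≤M = begin
  -- The extra factor of `primeCodeFrom-bound` at index 0, where `2 ^ 0` is 1; it is at least 1.
  primeCode as               ≤⟨ m≤m*n (primeCode as) (2 ^ (1 * M)) ⦃ m^n≢0 2 (1 * M) ⦄ ⟩
  primeCode as * 2 ^ (1 * M) ≤⟨ primeCodeFrom-bound M 0 as as≤M ⟩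
  2 ^ (2 ^ length as * M)    ∎

-- Growth of iterated factorials.

2^n≤n! : ∀ {n} → 4 ≤ n → 2 ^ n ≤ n !
2^n≤n! {n} 4≤n = subst (λ m → 2 ^ m ≤ m !) (m+[n∸m]≡n 4≤n) (go (n ∸ 4))
  where
  go : ∀ d → 2 ^ (4 + d) ≤ (4 + d) !
  go zero    = m≤m+n 16 8
  go (suc d) = *-mono-≤ (m≤m+n 2 (3 + d)) (go d)

-- The summand 8 is the increment of `8 * (4 + d)` in the next induction.
n+8≤2^n : ∀ {n} → 4 ≤ n → n + 8 ≤ 2 ^ n
n+8≤2^n {n} 4≤n = subst (λ m → m + 8 ≤ 2 ^ m) (m+[n∸m]≡n 4≤n) (go (n ∸ 4))
  where
  go : ∀ d → 4 + d + 8 ≤ 2 ^ (4 + d)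
  go zero    = m≤m+n 12 4
  go (suc d) = begin
    1 + (4 + d + 8)             ≤⟨ +-mono-≤ (m^n>0 2 (4 + d)) (go d) ⟩
    2 ^ (4 + d) + 2 ^ (4 + d)   ≡⟨ 2^-suc (4 + d) ⟨
    2 ^ (5 + d)                 ∎

-- One more factorial turns `x` into at least `2 ^ x`, hence at least `x + 8`, while the left side
-- grows by just 8. The base case is 32 ≤ 720, since `a 2` is (3!)!.
8*[4+d]≤a[2+d] : ∀ d → 8 * (4 + d) ≤ a (2 + d)
8*[4+d]≤a[2+d] zero    = m≤m+n 32 688
8*[4+d]≤a[2+d] (suc d) = begin
  8 * (5 + d)      ≡⟨ *-suc 8 (4 + d) ⟩
  8 + 8 * (4 + d)  ≡⟨ +-comm 8 _ ⟩
  8 * (4 + d) + 8  ≤⟨ +-monoˡ-≤ 8 IH ⟩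
  a (2 + d) + 8    ≤⟨ n+8≤2^n 4≤a ⟩
  2 ^ a (2 + d)    ≤⟨ 2^n≤n! 4≤a ⟩
  a (3 + d)        ∎
  where
  IH = 8*[4+d]≤a[2+d] d
  4≤a : 4 ≤ a (2 + d)
  4≤a = ≤-trans (≤-trans (m≤m+n 4 d) (m≤n*m (4 + d) 8)) IH

2^2^[8*L]≤a : ∀ {L} → 4 ≤ L → 2 ^ 2 ^ (8 * L) ≤ a L
2^2^[8*L]≤a {L} 4≤L = subst (λ m → 2 ^ 2 ^ (8 * m) ≤ a m) (m+[n∸m]≡n 4≤L) (go (L ∸ 4))
  where
  go : ∀ d → 2 ^ 2 ^ (8 * (4 + d)) ≤ a (4 + d)
  go d = begin
    2 ^ 2 ^ (8 * (4 + d)) ≤⟨ ^-monoʳ-≤ 2 (^-monoʳ-≤ 2 (8*[4+d]≤a[2+d] d)) ⟩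
    -- The two outermost factorials of `a (4 + d)` are traded for powers of 2, the inner one first.
    2 ^ 2 ^ a (2 + d)     ≤⟨ ^-monoʳ-≤ 2 (2^n≤n! 4≤a₂) ⟩
    2 ^ a (3 + d)         ≤⟨ 2^n≤n! 4≤a₃ ⟩
    a (4 + d)             ∎
    where
    4≤a₂ : 4 ≤ a (2 + d)
    4≤a₂ = ≤-trans (≤-trans (m≤m+n 4 d) (m≤n*m (4 + d) 8)) (8*[4+d]≤a[2+d] d)
    4≤a₃ : 4 ≤ a (3 + d)
    4≤a₃ = ≤-trans (≤-trans (m≤m+n 4 (suc d)) (m≤n*m (5 + d) 8)) (8*[4+d]≤a[2+d] (suc d))

-- Variable indices and symbol codes.

-- Bound variables count, also those right after a quantifier.
Varsᵗ : (ℕ → Set) → Term → Set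
Varsᵗ P (var x) = P x
Varsᵗ P 𝟎       = ⊤
Varsᵗ P (s ′)   = Varsᵗ P s
Varsᵗ P (s !ᵗ)  = Varsᵗ P s
Varsᵗ P (s ⊕ t) = Varsᵗ P s × Varsᵗ P t
Varsᵗ P (s ⊗ t) = Varsᵗ P s × Varsᵗ P t

Vars : (ℕ → Set) → Formula → Set
Vars P (s ≐ t)    = Varsᵗ P s × Varsᵗ P t
Vars P (~ A)      = Vars P A
Vars P (A ⊃ B)    = Vars P A × Vars P B
Vars P (∀[ x ] A) = P x × Vars P A

Varsᵗ-rename : ∀ {P Q : ℕ → Set} {ρ} → (∀ {x} → P x → Q (ρ x)) →
               ∀ t → Varsᵗ P t → Varsᵗ Q (renameᵗ ρ t)
Varsᵗ-rename f (var x) v       = f v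
Varsᵗ-rename f 𝟎       _       = _
Varsᵗ-rename f (s ′)   v       = Varsᵗ-rename f s v
Varsᵗ-rename f (s !ᵗ)  v       = Varsᵗ-rename f s v
Varsᵗ-rename f (s ⊕ t) (v , w) = Varsᵗ-rename f s v , Varsᵗ-rename f t w
Varsᵗ-rename f (s ⊗ t) (v , w) = Varsᵗ-rename f s v , Varsᵗ-rename f t w

Vars-rename : ∀ {P Q : ℕ → Set} {ρ} → (∀ {x} → P x → Q (ρ x)) →
              ∀ A → Vars P A → Vars Q (rename ρ A)
Vars-rename f (s ≐ t)    (v , w) = Varsᵗ-rename f s v , Varsᵗ-rename f t w
Vars-rename f (~ A)      v       = Vars-rename f A v
Vars-rename f (A ⊃ B)    (v , w) = Vars-rename f A v , Vars-rename f B w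
Vars-rename f (∀[ x ] A) (v , w) = f v , Vars-rename f A w

Varsᵗ-map : ∀ {P Q : ℕ → Set} → (∀ {x} → P x → Q x) → ∀ t → Varsᵗ P t → Varsᵗ Q t
Varsᵗ-map f (var x) v       = f v
Varsᵗ-map f 𝟎       _       = _
Varsᵗ-map f (s ′)   v       = Varsᵗ-map f s v
Varsᵗ-map f (s !ᵗ)  v       = Varsᵗ-map f s v
Varsᵗ-map f (s ⊕ t) (v , w) = Varsᵗ-map f s v , Varsᵗ-map f t w
Varsᵗ-map f (s ⊗ t) (v , w) = Varsᵗ-map f s v , Varsᵗ-map f t w

Vars-map : ∀ {P Q : ℕ → Set} → (∀ {x} → P x → Q x) → ∀ A → Vars P A → Vars Q A
Vars-map f (s ≐ t)    (v , w) = Varsᵗ-map f s v , Varsᵗ-map f t w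
Vars-map f (~ A)      v       = Vars-map f A v
Vars-map f (A ⊃ B)    (v , w) = Vars-map f A v , Vars-map f B w
Vars-map f (∀[ x ] A) (v , w) = f v , Vars-map f A w

CodesAtMost : ℕ → List Symbol → Set
CodesAtMost M = All (λ σ → # σ ≤ M)

-- A quantified variable is always written out, so bound variables are read off
-- from a spelling just like free ones.
spellsᵗ⇒Vars : ∀ {m w t} → w spellsᵗ t → CodesAtMost (2 * m + 27) w → Varsᵗ (_≤ m) t
spellsᵗ⇒Vars {m} (var k) (v ∷ []) = *-cancelˡ-≤ 2 (+-cancelʳ-≤ 27 (2 * k) (2 * m) v)
spellsᵗ⇒Vars 𝟎            _  = _
spellsᵗ⇒Vars (s ′)        vs = spellsᵗ⇒Vars s (proj₁ (∷ʳ⁻ vs))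
spellsᵗ⇒Vars (s !ᵗ)       vs = spellsᵗ⇒Vars s (proj₁ (∷ʳ⁻ vs))
spellsᵗ⇒Vars (_⊕_ {v} s t) vs with ++⁻ v vs
... | us , _ ∷ ws = spellsᵗ⇒Vars s us , spellsᵗ⇒Vars t ws
spellsᵗ⇒Vars (_⊗_ {v} s t) vs with ++⁻ v vs
... | us , _ ∷ ws = spellsᵗ⇒Vars s us , spellsᵗ⇒Vars t ws
spellsᵗ⇒Vars (brackets s) (_ ∷ vs) = spellsᵗ⇒Vars s (proj₁ (∷ʳ⁻ vs))

spells⇒Vars : ∀ {m w A} → w spells A → CodesAtMost (2 * m + 27) w → Vars (_≤ m) A
spells⇒Vars (_≐_ {v} s t) vs with ++⁻ v vs
... | us , _ ∷ ws = spellsᵗ⇒Vars s us , spellsᵗ⇒Vars t ws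
spells⇒Vars (~ A)         (_ ∷ vs) = spells⇒Vars A vs
spells⇒Vars (_⊃_ {v} A B) vs with ++⁻ v vs
... | us , _ ∷ ws = spells⇒Vars A us , spells⇒Vars B ws
spells⇒Vars {m} (∀[ k ] A) (_ ∷ v ∷ vs) =
  *-cancelˡ-≤ 2 (+-cancelʳ-≤ 27 (2 * k) (2 * m) v) , spells⇒Vars A vs
spells⇒Vars (brackets A) (_ ∷ vs) = spells⇒Vars A (proj₁ (∷ʳ⁻ vs))

module _ {m : ℕ} where

  private
    -- Every symbol that is not a variable has a code n ≤ 25.
    small : ∀ n {n≤25 : T (n ≤ᵇ 25)} → n ≤ 2 * m + 27
    small n {n≤25} = ≤-trans (≤-trans (≤ᵇ⇒≤ n 25 n≤25) (m≤m+n 25 2)) (m≤n+m 27 (2 * m))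

    variable-code : ∀ {x} → x ≤ m → # (variable! x) ≤ 2 * m + 27
    variable-code x≤m = +-monoˡ-≤ 27 (*-monoʳ-≤ 2 x≤m)

  Vars⇒spellsᵗ : ∀ {w t} → w spellsᵗ t → Varsᵗ (_≤ m) t → CodesAtMost (2 * m + 27) w
  Vars⇒spellsᵗ (var k)      v       = variable-code v ∷ []
  Vars⇒spellsᵗ 𝟎            _       = small (# zero) ∷ []
  Vars⇒spellsᵗ (s ′)        v       = ∷ʳ⁺ (Vars⇒spellsᵗ s v) (small (# succ))
  Vars⇒spellsᵗ (s !ᵗ)       v       = ∷ʳ⁺ (Vars⇒spellsᵗ s v) (small (# fact))
  Vars⇒spellsᵗ (s ⊕ t)      (v , w) = ++⁺ (Vars⇒spellsᵗ s v) (small (# plus) ∷ Vars⇒spellsᵗ t w)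
  Vars⇒spellsᵗ (s ⊗ t)      (v , w) = ++⁺ (Vars⇒spellsᵗ s v) (small (# times) ∷ Vars⇒spellsᵗ t w)
  Vars⇒spellsᵗ (brackets s) v       = small (# lpar) ∷ ∷ʳ⁺ (Vars⇒spellsᵗ s v) (small (# rpar))

  -- Induction on an arbitrary spelling, so the bound applies to whichever bracketing a convention
  -- picks.
  Vars⇒spells : ∀ {w A} → w spells A → Vars (_≤ m) A → CodesAtMost (2 * m + 27) w
  Vars⇒spells (s ≐ t)      (v , w) = ++⁺ (Vars⇒spellsᵗ s v) (small (# equals) ∷ Vars⇒spellsᵗ t w)
  Vars⇒spells (~ A)        v       = small (# neg) ∷ Vars⇒spells A v
  Vars⇒spells (A ⊃ B)      (v , w) = ++⁺ (Vars⇒spells A v) (small (# implies) ∷ Vars⇒spells B w)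
  Vars⇒spells (∀[ k ] A)   (v , w) = small (# forAll) ∷ variable-code v ∷ Vars⇒spells A w
  Vars⇒spells (brackets A) v       = small (# lpar) ∷ ∷ʳ⁺ (Vars⇒spells A v) (small (# rpar))

-- Variables of `D` and of its B-formula.

aᵗ-Vars : ∀ {P} L → Varsᵗ P (aᵗ L)
aᵗ-Vars zero    = _
aᵗ-Vars (suc L) = aᵗ-Vars L

-- The bound `k + 1` is attained by the inner quantified variable, and it is the range on which
-- `ShiftsVariables` controls the renaming.
D-Vars : ∀ R k L → Vars (_≤ k) R → Vars (_≤ k + 1) (D R k L)
D-Vars R k L vR =
  k∸2≤ , (≤-refl , aᵗ-Vars L , (k∸2≤ , ≤-refl) , _) , k∸1≤ , Vars-map (m≤n⇒m≤n+o 1) R vR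
  where
  k∸2≤ : k ∸ 2 ≤ k + 1
  k∸2≤ = ≤-trans (m∸n≤m k 2) (m≤m+n k 1)
  k∸1≤ : k ∸ 1 ≤ k + 1
  k∸1≤ = ≤-trans (m∸n≤m k 1) (m≤m+n k 1)

∃B-Vars : ∀ (P : ℕ → Set) A A′ {x y u v w} → Vars P A → Vars P A′ →
          P x → P y → P u → P v → P w → Vars P (∃B A A′ x y u v w)
∃B-Vars P A A′ vA vA′ x y u v w =
  x , vA , y , vA′ ,
  ((u , y , (x , u) , _) , v , x , (y , v) , _) , w , y , (x , w) , _

-- The largest index belongs to the last quantified variable of `minimal`; the renamed copy of `D`
-- stays within `2 * k + 3` by `upper`.
∃B-D-Vars : ∀ R k ρ L → Vars (_≤ k) R → ShiftsVariables k ρ →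
            Vars (_≤ 2 * k + 6) (∃B-D R k ρ L)
∃B-D-Vars R k ρ L vR shifts = ∃B-Vars (_≤ 2 * k + 6) D′ (rename ρ D′)
  (Vars-map {Q = _≤ 2 * k + 6} (λ i≤ → ≤-trans i≤ (+-mono-≤ k≤2k (m≤m+n 1 5))) D′ vD)
  (Vars-rename {Q = _≤ 2 * k + 6} (λ i≤ → ≤-trans (upper i≤) (+-monoʳ-≤ (2 * k) (m≤m+n 3 3))) D′ vD)
  (≤-trans k≤2k (m≤m+n (2 * k) 6))
  (+-mono-≤ k≤2k (m≤m+n 2 4))
  (+-monoʳ-≤ (2 * k) (m≤m+n 4 2))
  (+-monoʳ-≤ (2 * k) (m≤m+n 5 1))
  ≤-refl
  where
  open ShiftsVariables shifts
  D′ = D R k L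
  vD = D-Vars R k L vR
  k≤2k : k ≤ 2 * k
  k≤2k = m≤n*m k 2

-- Comparison of the Gödel code with `a L₂`.

theorem2 :
    (conv : BracketConvention) →
    let open BracketConvention conv
        open Coding conv
        open Relation-r conv
    in
    (k : ℕ) → 2 ≤ k →
    (R : Formula) →
    (∀ z → Free z R ⇔ (z ≡ k ∸ 2 ⊎ z ≡ k ∸ 1 ⊎ z ≡ k)) →
    Represents-r R (k ∸ 2) (k ∸ 1) k →
    (L₁ : ℕ) → length (string R) ≡ L₁ →
    max 0 (map # (string R)) ≡ 2 * k + 27 →
    (ρ : ℕ → ℕ) → ShiftsVariables k ρ →
    (c : ℕ) → (∀ L₂ → 1 ≤ L₂ → length (string (∃B-D R k ρ L₂)) ≡ 2 * L₁ + 6 * L₂ + c) →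
    (L₂ : ℕ) → L₂ > 4 → L₂ > 2 * L₁ + c + 1 → 2 ^ L₂ > 7 * L₂ * (4 * k + 39) →
    formulaCode (∃B-D R k ρ L₂) < a L₂
-- Matching `L₂` as a successor supplies the positivity used for `length≡` and for `M ≤ 7 * L₂ * M`.
theorem2 conv k _ R _ _ L₁ _ max≡ ρ shifts c length≡ L₂@(suc _) L₂>4 L₂> 2^L₂> = begin-strict
  formulaCode F              ≤⟨ primeCode-bound M codes codes≤M ⟩
  2 ^ (2 ^ length codes * M) <⟨ ^-monoʳ-< 2 (s≤s (s≤s z≤n)) exponent< ⟩
  2 ^ 2 ^ (8 * L₂)           ≤⟨ 2^2^[8*L]≤a (<⇒≤ L₂>4) ⟩
  a L₂                       ∎
  where
  open BracketConvention conv
  open Coding conv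

  F     = ∃B-D R k ρ L₂
  M     = 4 * k + 39
  codes = map # (string F)

  -- The hypothesis on the maximal code bounds every symbol of `R` by the code of the variable with
  -- index `k`, and hence every variable index, bound ones included.
  R-Vars : Vars (_≤ k) R
  R-Vars = spells⇒Vars (string-spells R)
    (map⁻ (subst (λ m → All (_≤ m) (map # (string R))) max≡ (xs≤max 0 (map # (string R)))))

  codes≤M : All (_≤ M) codes
  codes≤M = map⁺ (subst (λ m → CodesAtMost m (string F)) (code≡ k)
    (Vars⇒spells (string-spells F) (∃B-D-Vars R k ρ L₂ R-Vars shifts)))
    where
    code≡ : ∀ k → 2 * (2 * k + 6) + 27 ≡ 4 * k + 39
    code≡ = solve-∀

  length≤ : length codes ≤ 7 * L₂
  length≤ = begin
    length codes               ≡⟨ trans (length-map # (string F)) (length≡ L₂ (s≤s z≤n)) ⟩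
    2 * L₁ + 6 * L₂ + c        ≡⟨ rearrange (2 * L₁) (6 * L₂) c ⟩
    -- The second hypothesis on `L₂` absorbs `2 * L₁ + c` into a seventh `L₂`.
    2 * L₁ + c + 6 * L₂        ≤⟨ +-monoˡ-≤ (6 * L₂) (≤-trans (m≤m+n (2 * L₁ + c) 1) (<⇒≤ L₂>)) ⟩
    7 * L₂                     ∎
    where
    rearrange : ∀ x y z → x + y + z ≡ x + z + y
    rearrange = solve-∀

  exponent< : 2 ^ length codes * M < 2 ^ (8 * L₂)
  exponent< = begin-strict
    2 ^ length codes * M  ≤⟨ *-monoˡ-≤ M (^-monoʳ-≤ 2 length≤) ⟩
    -- The factor `7 * L₂` is inserted to match the hypothesis on `2 ^ L₂`.
    2 ^ (7 * L₂) * M      ≤⟨ *-monoʳ-≤ (2 ^ (7 * L₂)) (m≤n*m M (7 * L₂)) ⟩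
    2 ^ (7 * L₂) * (7 * L₂ * M) <⟨ *-monoʳ-< (2 ^ (7 * L₂)) ⦃ m^n≢0 2 (7 * L₂) ⦄ 2^L₂> ⟩
    2 ^ (7 * L₂) * 2 ^ L₂ ≡⟨ ^-distribˡ-+-* 2 (7 * L₂) L₂ ⟨
    2 ^ (7 * L₂ + L₂)     ≡⟨ cong (2 ^_) (+-comm (7 * L₂) L₂) ⟩
    2 ^ (8 * L₂)          ∎
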